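{- Let $G$ be a partial cube obtained by edge-pasting from finite partial cubes $G_1$ and $G_2$. Then $$\max\{\dim_Z(G_1),\dim_Z(G_2)\}\leq\dim_Z(G)\leq\dim_Z(G_1)+\dim_Z(G_2).$$
   Context: Graphs are simple, undirected and nonempty. For a set $X$, the hypercube $\mathcal H(X)$ is the graph whose vertices are the finite subsets of $X$, with $P,Q$ adjacent iff $|P\Delta Q|=1$. A graph is a partial cube if it can be isometrically embedded (i.e. by a map preserving shortest-path distances) into some $\mathcal H(X)$. The integer lattice $\mathcal Z^n$ is the graph with vertex set $\mathbb Z^n$ in which two vertices are adjacent iff their $\ell_1$-distance is $1$. The lattice dimension $\dim_Z(G)$ of a finite partial cube $G$ is the minimum $n$ such that $G$ is isometrically embeddable into $\mathcal Z^n$ (every finite partial cube is so embeddable for some $n$). Edge-pasting: given connected graphs $G_1=(V_1,E_1)$, $G_2=(V_2,E_2)$ and edges $a_1b_1\in E_1$, $a_2b_2\in E_2$, the graph obtained by edge-pasting is the graph obtained from the disjoint union of $G_1$ and $G_2$ by identifying $a_1$ with $a_2$, $b_1$ with $b_2$, and the edge $a_1b_1$ with the edge $a_2b_2$ (and making no other identifications). -}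

module Defs where

open import Data.Empty using (⊥)
open import Data.Fin using (Fin)
open import Data.Integer using (ℤ; +_; _-_; ∣_∣)
open import Data.Integer.Properties using (∣i-j∣≡∣j-i∣; +-inverseʳ)
open import Data.List using (List; [])
open import Data.List.Membership.Propositional using (_∈_)
open import Data.List.Relation.Binary.BagAndSetEquality using ([_]-Equality; set)
open import Data.Nat using (ℕ; zero; suc; _+_; _≤_)
open import Data.Product using (∃; ∃!; _×_; _,_; proj₁; proj₂)
open import Data.Sum using (_⊎_; inj₁; inj₂; swap; map)
open import Data.Vec using (Vec; []; _∷_; sum; zipWith; replicate)
open import Function using (_⇔_; _∘_)
open import Function.Bundles using (Func; Inverse; Equivalence)
open import Level using (0ℓ)
open import Relation.Binary using (Setoid; Rel; IsEquivalence)
import Relation.Binary.Construct.Closure.Equivalence as EqC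
open import Relation.Binary.PropositionalEquality as ≡ using (_≡_; refl)
open import Relation.Nullary using (¬_)
open import Relation.Unary using (Pred; _∖_; _∪_)

-- Vertices form a setoid so that a quotient of a graph is again a graph;
-- "the same vertex" always means _≈_.
record Graph : Set₁ where
  infix 4 _~_
  field
    vertices : Setoid 0ℓ 0ℓ

  open Setoid vertices public using (_≈_) renaming
    ( Carrier to Vertex
    ; refl to ≈-refl
    ; sym to ≈-sym
    ; trans to ≈-trans
    ; isEquivalence to ≈-isEquivalence
    )

  field
    _~_      : Rel Vertex 0ℓ
    ~-resp-≈ : ∀ {u u′ v v′} → u ≈ u′ → v ≈ v′ → u ~ v → u′ ~ v′
    ~-sym    : ∀ {u v} → u ~ v → v ~ u
    ~-irrefl : ∀ {u v} → u ≈ v → ¬ (u ~ v)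
    nonempty : Vertex

open Graph using (vertices; Vertex)

Finite : Graph → Set
Finite G = ∃ λ n → Inverse (vertices G) (≡.setoid (Fin n))

module _ (G : Graph) where
  open Graph G hiding (vertices; Vertex)

  data Walk : Vertex G → Vertex G → ℕ → Set where
    stop : ∀ {u v} → u ≈ v → Walk u v zero
    step : ∀ {u v w n} → u ~ v → Walk v w n → Walk u w (suc n)

  -- Shortest-path distance as a relation; it holds for no n exactly when u
  -- and v are in different components (distance ∞).
  Distance : Vertex G → Vertex G → ℕ → Set
  Distance u v n = Walk u v n × (∀ m → Walk u v m → n ≤ m)

-- The equivalence, required for every n, also says that infinite distances
-- correspond.
IsIsometric : (G H : Graph) → (Vertex G → Vertex H) → Set
IsIsometric G H f = ∀ u v n → Distance G u v n ⇔ Distance H (f u) (f v) n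

IsometricallyEmbeddable : Graph → Graph → Set
IsometricallyEmbeddable G H =
  ∃ λ (f : Func (vertices G) (vertices H)) → IsIsometric G H (Func.to f)

-- A finite subset is given by a list of its elements; order and repetitions
-- are forgotten by the vertex equality of Hypercube below.
_Δ_ : {X : Set} → List X → List X → Pred X 0ℓ
P Δ Q = ((_∈ P) ∖ (_∈ Q)) ∪ ((_∈ Q) ∖ (_∈ P))

private
  Δ-resp : {X : Set} {P P′ Q Q′ : List X} → let open Setoid ([ set ]-Equality X) in
           P ≈ P′ → Q ≈ Q′ → ∀ {x} → (P Δ Q) x → (P′ Δ Q′) x
  Δ-resp p q = map
    (λ (x∈P , x∉Q) → Equivalence.to p x∈P , x∉Q ∘ Equivalence.from q)
    (λ (x∈Q , x∉P) → Equivalence.to q x∈Q , x∉P ∘ Equivalence.from p)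

-- Adjacency is |P Δ Q| = 1: the symmetric difference has exactly one element.
Hypercube : Set → Graph
Hypercube X = record
  { vertices = [ set ]-Equality X
  ; _~_      = λ P Q → ∃! _≡_ (P Δ Q)
  ; ~-resp-≈ = λ {P} {P′} {Q} {Q′} p q (x , x∈ , uniq) →
      x , Δ-resp {P = P} {P′} {Q} {Q′} p q x∈
        , uniq ∘ Δ-resp {P = P′} {P} {Q′} {Q} (sym p) (sym q)
  ; ~-sym    = λ (x , x∈ , uniq) → x , swap x∈ , uniq ∘ swap
  ; ~-irrefl = λ
      { p (x , inj₁ (x∈P , x∉Q) , _) → x∉Q (Equivalence.to p x∈P)
      ; p (x , inj₂ (x∈Q , x∉P) , _) → x∉P (Equivalence.from p x∈Q)
      }
  ; nonempty = []
  }
  where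
  sym : {P Q : List X} → let open Setoid ([ set ]-Equality X) in P ≈ Q → Q ≈ P
  sym {P} {Q} = Setoid.sym ([ set ]-Equality X) {P} {Q}

IsPartialCube : Graph → Set₁
IsPartialCube G = ∃ λ (X : Set) → IsometricallyEmbeddable G (Hypercube X)

ℓ₁ : ∀ {n} → Vec ℤ n → Vec ℤ n → ℕ
ℓ₁ x y = sum (zipWith (λ i j → ∣ i - j ∣) x y)

private
  ℓ₁-sym : ∀ {n} (x y : Vec ℤ n) → ℓ₁ x y ≡ ℓ₁ y x
  ℓ₁-sym []      []      = refl
  ℓ₁-sym (i ∷ x) (j ∷ y) = ≡.cong₂ _+_ (∣i-j∣≡∣j-i∣ i j) (ℓ₁-sym x y)

  ℓ₁-refl : ∀ {n} (x : Vec ℤ n) → ℓ₁ x x ≡ 0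
  ℓ₁-refl []      = refl
  ℓ₁-refl (i ∷ x) = ≡.cong₂ _+_ (≡.cong ∣_∣ (+-inverseʳ i)) (ℓ₁-refl x)

Lattice : ℕ → Graph
Lattice n = record
  { vertices = ≡.setoid (Vec ℤ n)
  ; _~_      = λ x y → ℓ₁ x y ≡ 1
  ; ~-resp-≈ = λ { refl refl x~y → x~y }
  ; ~-sym    = λ {x} {y} x~y → ≡.trans (ℓ₁-sym y x) x~y
  ; ~-irrefl = λ { {x} refl x~x → 0≢1 (≡.trans (≡.sym (ℓ₁-refl x)) x~x) }
  ; nonempty = replicate n (+ 0)
  }
  where
  0≢1 : ¬ (0 ≡ 1)
  0≢1 ()

-- dim_Z(G) = n, i.e. n is the least dimension of a lattice into which G
-- embeds isometrically; such an n is unique by antisymmetry of _≤_.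
IsLatticeDimension : Graph → ℕ → Set
IsLatticeDimension G n =
  IsometricallyEmbeddable G (Lattice n) ×
  (∀ m → IsometricallyEmbeddable G (Lattice m) → n ≤ m)

module EdgePasting
  (G₁ G₂ : Graph)
  {a₁ b₁ : Vertex G₁} (a₁b₁ : Graph._~_ G₁ a₁ b₁)
  {a₂ b₂ : Vertex G₂} (a₂b₂ : Graph._~_ G₂ a₂ b₂)
  where

  private
    module G₁ = Graph G₁
    module G₂ = Graph G₂

  V : Set
  V = Vertex G₁ ⊎ Vertex G₂

  data Identify : Rel V 0ℓ where
    within₁ : ∀ {u v} → u G₁.≈ v → Identify (inj₁ u) (inj₁ v)
    within₂ : ∀ {u v} → u G₂.≈ v → Identify (inj₂ u) (inj₂ v)
    a₁≡a₂   : Identify (inj₁ a₁) (inj₂ a₂)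
    b₁≡b₂   : Identify (inj₁ b₁) (inj₂ b₂)

  pastedVertices : Setoid 0ℓ 0ℓ
  pastedVertices = EqC.setoid Identify

  open Setoid pastedVertices using (_≈_; refl; sym; trans)

  -- Adjacency of the images of adjacent vertices. Since the ends of a₁b₁ and
  -- a₂b₂ are identified, so are the two edges.
  data _~_ (u v : V) : Set where
    edge₁ : ∀ {x y} → u ≈ inj₁ x → v ≈ inj₁ y → x G₁.~ y → u ~ v
    edge₂ : ∀ {x y} → u ≈ inj₂ x → v ≈ inj₂ y → x G₂.~ y → u ~ v

  -- An explicit description of _≈_, needed for irreflexivity.
  Same : Rel V 0ℓ
  Same (inj₁ x) (inj₁ y) = x G₁.≈ y
  Same (inj₁ x) (inj₂ y) = (x G₁.≈ a₁ × y G₂.≈ a₂) ⊎ (x G₁.≈ b₁ × y G₂.≈ b₂)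
  Same (inj₂ x) (inj₁ y) = (y G₁.≈ a₁ × x G₂.≈ a₂) ⊎ (y G₁.≈ b₁ × x G₂.≈ b₂)
  Same (inj₂ x) (inj₂ y) = x G₂.≈ y

  private
    a₁≉b₁ : ∀ {x} → x G₁.≈ a₁ → x G₁.≈ b₁ → ⊥
    a₁≉b₁ p q = G₁.~-irrefl (G₁.≈-trans (G₁.≈-sym p) q) a₁b₁

    a₂≉b₂ : ∀ {x} → x G₂.≈ a₂ → x G₂.≈ b₂ → ⊥
    a₂≉b₂ p q = G₂.~-irrefl (G₂.≈-trans (G₂.≈-sym p) q) a₂b₂

    Same-trans : ∀ u v w → Same u v → Same v w → Same u w
    Same-trans (inj₁ _) (inj₁ _) (inj₁ _) p q = G₁.≈-trans p q
    Same-trans (inj₁ _) (inj₁ _) (inj₂ _) p (inj₁ (q , r)) = inj₁ (G₁.≈-trans p q , r)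
    Same-trans (inj₁ _) (inj₁ _) (inj₂ _) p (inj₂ (q , r)) = inj₂ (G₁.≈-trans p q , r)
    Same-trans (inj₁ _) (inj₂ _) (inj₁ _) (inj₁ (p , _)) (inj₁ (r , _)) = G₁.≈-trans p (G₁.≈-sym r)
    Same-trans (inj₁ _) (inj₂ _) (inj₁ _) (inj₁ (_ , q)) (inj₂ (_ , s)) with () ← a₂≉b₂ q s
    Same-trans (inj₁ _) (inj₂ _) (inj₁ _) (inj₂ (_ , q)) (inj₁ (_ , s)) with () ← a₂≉b₂ s q
    Same-trans (inj₁ _) (inj₂ _) (inj₁ _) (inj₂ (p , _)) (inj₂ (r , _)) = G₁.≈-trans p (G₁.≈-sym r)
    Same-trans (inj₁ _) (inj₂ _) (inj₂ _) (inj₁ (p , q)) r = inj₁ (p , G₂.≈-trans (G₂.≈-sym r) q)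
    Same-trans (inj₁ _) (inj₂ _) (inj₂ _) (inj₂ (p , q)) r = inj₂ (p , G₂.≈-trans (G₂.≈-sym r) q)
    Same-trans (inj₂ _) (inj₁ _) (inj₁ _) (inj₁ (p , q)) r = inj₁ (G₁.≈-trans (G₁.≈-sym r) p , q)
    Same-trans (inj₂ _) (inj₁ _) (inj₁ _) (inj₂ (p , q)) r = inj₂ (G₁.≈-trans (G₁.≈-sym r) p , q)
    Same-trans (inj₂ _) (inj₁ _) (inj₂ _) (inj₁ (_ , q)) (inj₁ (_ , s)) = G₂.≈-trans q (G₂.≈-sym s)
    Same-trans (inj₂ _) (inj₁ _) (inj₂ _) (inj₁ (p , _)) (inj₂ (r , _)) with () ← a₁≉b₁ p r
    Same-trans (inj₂ _) (inj₁ _) (inj₂ _) (inj₂ (p , _)) (inj₁ (r , _)) with () ← a₁≉b₁ r p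
    Same-trans (inj₂ _) (inj₁ _) (inj₂ _) (inj₂ (_ , q)) (inj₂ (_ , s)) = G₂.≈-trans q (G₂.≈-sym s)
    Same-trans (inj₂ _) (inj₂ _) (inj₁ _) p (inj₁ (q , r)) = inj₁ (q , G₂.≈-trans p r)
    Same-trans (inj₂ _) (inj₂ _) (inj₁ _) p (inj₂ (q , r)) = inj₂ (q , G₂.≈-trans p r)
    Same-trans (inj₂ _) (inj₂ _) (inj₂ _) p q = G₂.≈-trans p q

    Same-refl : ∀ u → Same u u
    Same-refl (inj₁ _) = G₁.≈-refl
    Same-refl (inj₂ _) = G₂.≈-refl

    Same-sym : ∀ u v → Same u v → Same v u
    Same-sym (inj₁ _) (inj₁ _) p = G₁.≈-sym p
    Same-sym (inj₁ _) (inj₂ _) p = p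
    Same-sym (inj₂ _) (inj₁ _) p = p
    Same-sym (inj₂ _) (inj₂ _) p = G₂.≈-sym p

  Same-isEquivalence : IsEquivalence Same
  Same-isEquivalence = record
    { refl  = λ {u} → Same-refl u
    ; sym   = λ {u} {v} → Same-sym u v
    ; trans = λ {u} {v} {w} → Same-trans u v w
    }

  ≈⇒Same : ∀ {u v} → u ≈ v → Same u v
  ≈⇒Same = EqC.fold Same-isEquivalence λ
    { (within₁ p) → p
    ; (within₂ p) → p
    ; a₁≡a₂       → inj₁ (G₁.≈-refl , G₂.≈-refl)
    ; b₁≡b₂       → inj₂ (G₁.≈-refl , G₂.≈-refl)
    }

  private
    ~-resp-≈ : ∀ {u u′ v v′} → u ≈ u′ → v ≈ v′ → u ~ v → u′ ~ v′
    ~-resp-≈ p q (edge₁ r s e) = edge₁ (trans (sym p) r) (trans (sym q) s) e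
    ~-resp-≈ p q (edge₂ r s e) = edge₂ (trans (sym p) r) (trans (sym q) s) e

    ~-sym : ∀ {u v} → u ~ v → v ~ u
    ~-sym (edge₁ r s e) = edge₁ s r (G₁.~-sym e)
    ~-sym (edge₂ r s e) = edge₂ s r (G₂.~-sym e)

    ~-irrefl : ∀ {u v} → u ≈ v → ¬ (u ~ v)
    ~-irrefl p (edge₁ r s e) = G₁.~-irrefl (≈⇒Same (trans (sym r) (trans p s))) e
    ~-irrefl p (edge₂ r s e) = G₂.~-irrefl (≈⇒Same (trans (sym r) (trans p s))) e

  pasted : Graph
  pasted = record
    { vertices = pastedVertices
    ; _~_      = _~_
    ; ~-resp-≈ = ~-resp-≈
    ; ~-sym    = ~-sym
    ; ~-irrefl = ~-irrefl
    ; nonempty = inj₁ (Graph.nonempty G₁)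
    }

open EdgePasting public using () renaming (pasted to edgePaste)

{-# OPTIONS --safe #-}

-- Let f₁ and f₂ embed G₁ and G₂ isometrically into lattices. Every vertex v of
-- G₂ is strictly nearer to one end s of the pasted edge, and v is joined to the
-- vertices u of G₁ by shortest paths through s. Since f₂ a₂ and f₂ b₂ differ by a
-- unit vector, translating the half of f₂ G₂ nearer to b₂ by f₂ a₂ - f₂ b₂
-- contracts exactly the edges parallel to a₂b₂, which are recovered from the
-- G₁-coordinates f₁ a₁ and f₁ b₁ of the two halves. Hence
--   u ↦ (f₁ u , f₂ a₂)   and   v ↦ (f₁ s , f₂ v + (f₂ a₂ - f₂ s))
-- define an isometric embedding of the pasted graph into the lattice of dimension
-- d₁ + d₂. It restricts to isometries of G₁ and G₂, so both are isometric in the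
-- pasted graph, which gives the lower bound.
module Submission where

open import Defs
open import Data.Empty using (⊥-elim)
open import Data.Integer as ℤ using (ℤ; +0; +[1+_]; -[1+_]; ∣_∣; 1ℤ; -1ℤ)
import Data.Integer.Properties as ℤ
import Data.Integer.Tactic.RingSolver as ℤ-Solver
open import Data.Nat using (ℕ; zero; suc; _+_; _≤_; _⊔_; z≤n; s≤s)
open import Data.Nat.Properties
open import Data.Nat.Tactic.RingSolver using (solve-∀)
open import Data.Product using (_×_; _,_; ∃; proj₁; proj₂)
open import Data.Sum using (_⊎_; inj₁; inj₂)
open import Data.Vec using (Vec; []; _∷_; _++_; sum; zipWith)
open import Data.Vec.Properties using (zipWith-++; sum-++; zipWith-comm)
open import Function using (_∘_; mk⇔)
open import Function.Bundles using (Func; Equivalence)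
open import Function.Construct.Composition using () renaming (function to compose)
import Relation.Binary.Construct.Closure.Equivalence as EqC
open import Relation.Binary.PropositionalEquality

open Graph using (vertices; Vertex)

private
  variable
    m n : ℕ

-- The `ℓ₁` metric on integer vectors.

dist : ℤ → ℤ → ℕ
dist i j = ∣ i ℤ.- j ∣

ℓ₁-refl : (x : Vec ℤ n) → ℓ₁ x x ≡ 0
ℓ₁-refl []      = refl
ℓ₁-refl (i ∷ x) = cong₂ _+_ (cong ∣_∣ (ℤ.+-inverseʳ i)) (ℓ₁-refl x)

ℓ₁-sym : (x y : Vec ℤ n) → ℓ₁ x y ≡ ℓ₁ y x
ℓ₁-sym x y = cong sum (zipWith-comm ℤ.∣i-j∣≡∣j-i∣ x y)

ℓ₁≡0⇒≡ : (x y : Vec ℤ n) → ℓ₁ x y ≡ 0 → x ≡ y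
ℓ₁≡0⇒≡ []      []      _  = refl
ℓ₁≡0⇒≡ (i ∷ x) (j ∷ y) eq = cong₂ _∷_
  (ℤ.i-j≡0⇒i≡j i j (ℤ.∣i∣≡0⇒i≡0 (m+n≡0⇒m≡0 (dist i j) eq)))
  (ℓ₁≡0⇒≡ x y (m+n≡0⇒n≡0 (dist i j) eq))

dist-triangle : ∀ i j k → dist i k ≤ dist i j + dist j k
dist-triangle i j k = begin
  ∣ i ℤ.- k ∣                     ≡⟨ cong ∣_∣ (telescope i j k) ⟩
  ∣ (i ℤ.- j) ℤ.+ (j ℤ.- k) ∣     ≤⟨ ℤ.∣i+j∣≤∣i∣+∣j∣ (i ℤ.- j) (j ℤ.- k) ⟩
  dist i j + dist j k             ∎
  where
  open ≤-Reasoning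
  telescope : ∀ i j k → i ℤ.- k ≡ (i ℤ.- j) ℤ.+ (j ℤ.- k)
  telescope = ℤ-Solver.solve-∀

interchange : ∀ a b c d → (a + b) + (c + d) ≡ (a + c) + (b + d)
interchange = solve-∀

ℓ₁-triangle : (x y z : Vec ℤ n) → ℓ₁ x z ≤ ℓ₁ x y + ℓ₁ y z
ℓ₁-triangle []      []      []      = z≤n
ℓ₁-triangle (i ∷ x) (j ∷ y) (k ∷ z) = begin
  dist i k + ℓ₁ x z                            ≤⟨ +-mono-≤ (dist-triangle i j k) (ℓ₁-triangle x y z) ⟩
  (dist i j + dist j k) + (ℓ₁ x y + ℓ₁ y z)    ≡⟨ interchange (dist i j) (dist j k) (ℓ₁ x y) (ℓ₁ y z) ⟩
  (dist i j + ℓ₁ x y) + (dist j k + ℓ₁ y z)    ∎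
  where open ≤-Reasoning

ℓ₁-++ : (x y : Vec ℤ m) (x′ y′ : Vec ℤ n) → ℓ₁ (x ++ x′) (y ++ y′) ≡ ℓ₁ x y + ℓ₁ x′ y′
ℓ₁-++ x y x′ y′ = trans (cong sum (zipWith-++ dist x x′ y y′)) (sum-++ (zipWith dist x y))

ℓ₁-translate : (t x y : Vec ℤ n) → ℓ₁ (zipWith ℤ._+_ x t) (zipWith ℤ._+_ y t) ≡ ℓ₁ x y
ℓ₁-translate []      []      []      = refl
ℓ₁-translate (k ∷ t) (i ∷ x) (j ∷ y) = cong₂ _+_ (cong ∣_∣ (cancel i j k)) (ℓ₁-translate t x y)
  where
  cancel : ∀ i j k → (i ℤ.+ k) ℤ.- (j ℤ.+ k) ≡ i ℤ.- j
  cancel = ℤ-Solver.solve-∀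

-- Unit steps towards a target.

i-[i-j]≡j : ∀ i j → i ℤ.- (i ℤ.- j) ≡ j
i-[i-j]≡j = ℤ-Solver.solve-∀

i-j-k≡i-k-j : ∀ i j k → (i ℤ.- j) ℤ.- k ≡ (i ℤ.- k) ℤ.- j
i-j-k≡i-k-j = ℤ-Solver.solve-∀

-- Subtracting the sign of `i - j` from `i` brings it one unit closer to `j`.
dist-step : ∀ i j {k} → dist i j ≡ suc k → ∃ λ i′ → dist i i′ ≡ 1 × dist i′ j ≡ k
dist-step i j eq with i ℤ.- j in i-j
dist-step i j refl | +[1+ k ] = i ℤ.- 1ℤ , cong ∣_∣ (i-[i-j]≡j i 1ℤ) ,
  cong ∣_∣ (trans (i-j-k≡i-k-j i 1ℤ j) (cong (ℤ._- 1ℤ) i-j))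
dist-step i j refl | -[1+ k ] = i ℤ.- -1ℤ , cong ∣_∣ (i-[i-j]≡j i -1ℤ) ,
  trans (cong ∣_∣ (trans (i-j-k≡i-k-j i -1ℤ j) (cong (ℤ._- -1ℤ) i-j))) (∣-[1+k]+1∣ k)
  where
  ∣-[1+k]+1∣ : ∀ k → ∣ -[1+ k ] ℤ.- -1ℤ ∣ ≡ k
  ∣-[1+k]+1∣ zero    = refl
  ∣-[1+k]+1∣ (suc k) = refl

-- The step is taken in the first coordinate where `x` and `y` differ. Iterating it produces a
-- lattice walk of length `ℓ₁ x y`.
ℓ₁-step : (x y : Vec ℤ n) → ∀ {k} → ℓ₁ x y ≡ suc k → ∃ λ z → ℓ₁ x z ≡ 1 × ℓ₁ z y ≡ k
ℓ₁-step []      []      ()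
ℓ₁-step (i ∷ x) (j ∷ y) eq with dist i j in i-j
... | zero  = let z , x~z , z-y = ℓ₁-step x y eq in
  i ∷ z , cong₂ _+_ (cong ∣_∣ (ℤ.+-inverseʳ i)) x~z , cong₂ _+_ i-j z-y
... | suc k = let i′ , i~i′ , i′-j = dist-step i j i-j in
  i′ ∷ x , cong₂ _+_ i~i′ (ℓ₁-refl x) , trans (cong (_+ ℓ₁ x y) i′-j) (suc-injective eq)

-- Walks and distances in a graph.

module _ (G : Graph) where
  open Graph G hiding (vertices; Vertex)

  walk-respˡ : ∀ {u v w k} → u ≈ v → Walk G v w k → Walk G u w k
  walk-respˡ u≈v (stop v≈w)   = stop (≈-trans u≈v v≈w)
  walk-respˡ u≈v (step v~x p) = step (~-resp-≈ (≈-sym u≈v) ≈-refl v~x) p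

  walk-trans : ∀ {u v w k l} → Walk G u v k → Walk G v w l → Walk G u w (k + l)
  walk-trans (stop u≈v)   q = walk-respˡ u≈v q
  walk-trans (step u~x p) q = step u~x (walk-trans p q)

  walk-reverse : ∀ {u v k} → Walk G u v k → Walk G v u k
  walk-reverse (stop u≈v)                   = stop (≈-sym u≈v)
  walk-reverse (step {u} {x} {v} {k} u~x p) = subst (Walk G v u) (+-comm k 1)
    (walk-trans (walk-reverse p) (step (~-sym u~x) (stop ≈-refl)))

  distance-unique : ∀ {u v k l} → Distance G u v k → Distance G u v l → k ≡ l
  distance-unique (p , p-min) (q , q-min) = ≤-antisym (p-min _ q) (q-min _ p)

  -- A map that stretches no edge beyond length 1 stretches no walk, by the triangle inequality.
  -- This bounds distances from below, in the lattice itself and in the pasted graph.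
  walk-length≥ℓ₁ : (f : Vertex G → Vec ℤ n) → (∀ {u v} → u ≈ v → f u ≡ f v) →
                   (∀ {u v} → u ~ v → ℓ₁ (f u) (f v) ≤ 1) →
                   ∀ {u v k} → Walk G u v k → ℓ₁ (f u) (f v) ≤ k
  walk-length≥ℓ₁ f f-cong f-edge {u} {v} (stop u≈v) = begin
    ℓ₁ (f u) (f v)  ≡⟨ cong (ℓ₁ (f u)) (f-cong u≈v) ⟨
    ℓ₁ (f u) (f u)  ≡⟨ ℓ₁-refl (f u) ⟩
    0               ∎
    where open ≤-Reasoning
  walk-length≥ℓ₁ f f-cong f-edge {u} {w} (step {v = v} {n = k} u~v p) = begin
    ℓ₁ (f u) (f w)                   ≤⟨ ℓ₁-triangle (f u) (f v) (f w) ⟩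
    ℓ₁ (f u) (f v) + ℓ₁ (f v) (f w)  ≤⟨ +-mono-≤ (f-edge u~v) (walk-length≥ℓ₁ f f-cong f-edge p) ⟩
    suc k                            ∎
    where open ≤-Reasoning

walk-map : (G H : Graph) (f : Func (vertices G) (vertices H)) →
           (∀ {u v} → Graph._~_ G u v → Graph._~_ H (Func.to f u) (Func.to f v)) →
           ∀ {u v k} → Walk G u v k → Walk H (Func.to f u) (Func.to f v) k
walk-map G H f f-edge (stop u≈v)   = stop (Func.cong f u≈v)
walk-map G H f f-edge (step u~v p) = step (f-edge u~v) (walk-map G H f f-edge p)

-- Lattice distance and isometric maps into the lattice.

lattice-walk : (x y : Vec ℤ n) → ∀ k → ℓ₁ x y ≡ k → Walk (Lattice n) x y k
lattice-walk x y zero    eq = stop (ℓ₁≡0⇒≡ x y eq)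
lattice-walk x y (suc k) eq =
  let z , x~z , z-y = ℓ₁-step x y eq in step x~z (lattice-walk z y k z-y)

lattice-distance : (x y : Vec ℤ n) → Distance (Lattice n) x y (ℓ₁ x y)
lattice-distance {n} x y =
  lattice-walk x y (ℓ₁ x y) refl ,
  λ _ → walk-length≥ℓ₁ (Lattice n) (λ x → x) (λ eq → eq) ≤-reflexive

module _ (G : Graph) (f : Vertex G → Vec ℤ n) where
  isometric⇒distance : IsIsometric G (Lattice n) f → ∀ u v → Distance G u v (ℓ₁ (f u) (f v))
  isometric⇒distance iso u v = Equivalence.from (iso u v _) (lattice-distance (f u) (f v))

  -- Distances are unique, so one realised value for each pair settles the equivalence at every
  -- length; infinite distances occur on neither side.
  distance⇒isometric : (∀ u v → Distance G u v (ℓ₁ (f u) (f v))) → IsIsometric G (Lattice n) f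
  distance⇒isometric f-dist u v k = mk⇔
    (λ d → subst (Distance (Lattice n) (f u) (f v)) (distance-unique G (f-dist u v) d)
      (lattice-distance (f u) (f v)))
    (λ d → subst (Distance G u v)
      (distance-unique (Lattice n) (lattice-distance (f u) (f v)) d) (f-dist u v))

-- The two halves of the lattice cut by an edge, and the contraction of that edge.

data UnitStep : Vec ℤ n → Vec ℤ n → Set where
  here  : ∀ {i j} {x : Vec ℤ n} → dist i j ≡ 1 → UnitStep (i ∷ x) (j ∷ x)
  there : ∀ {i} {x y : Vec ℤ n} → UnitStep x y → UnitStep (i ∷ x) (i ∷ y)

-- Exposes the one coordinate in which adjacent vectors differ, so that induction reduces claims
-- about an edge to dimension one.
unitStep : (x y : Vec ℤ n) → ℓ₁ x y ≡ 1 → UnitStep x y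
unitStep []      []      ()
unitStep (i ∷ x) (j ∷ y) eq with dist i j in i-j
... | zero with refl ← ℤ.i-j≡0⇒i≡j i j (ℤ.∣i∣≡0⇒i≡0 i-j) = there (unitStep x y eq)
... | suc zero with refl ← ℓ₁≡0⇒≡ x y (suc-injective eq) = here i-j

Nearer : Vec ℤ n → Vec ℤ n → Vec ℤ n → Set
Nearer p q x = ℓ₁ x q ≡ suc (ℓ₁ x p)

shift : Vec ℤ n → Vec ℤ n → Vec ℤ n → Vec ℤ n
shift p q x = zipWith ℤ._+_ x (zipWith ℤ._-_ p q)

shift-q : (p q : Vec ℤ n) → shift p q q ≡ p
shift-q []      []      = refl
shift-q (i ∷ p) (j ∷ q) = cong₂ _∷_ (cancel i j) (shift-q p q)
  where
  cancel : ∀ i j → j ℤ.+ (i ℤ.- j) ≡ i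
  cancel = ℤ-Solver.solve-∀

shift-p-p : (p x : Vec ℤ n) → shift p p x ≡ x
shift-p-p []      []      = refl
shift-p-p (i ∷ p) (k ∷ x) = cong₂ _∷_ (cancel i k) (shift-p-p p x)
  where
  cancel : ∀ i k → k ℤ.+ (i ℤ.- i) ≡ k
  cancel = ℤ-Solver.solve-∀

-- The one-dimensional edge joins 0 to `e`, and no integer is equidistant from its ends.
∣s∣-dichotomy : ∀ s e → ∣ e ∣ ≡ 1 → ∣ s ℤ.- e ∣ ≡ suc ∣ s ∣ ⊎ ∣ s ∣ ≡ suc ∣ s ℤ.- e ∣
∣s∣-dichotomy +0           +[1+ 0 ] refl = inj₁ refl
∣s∣-dichotomy +[1+ k ]     +[1+ 0 ] refl = inj₂ refl
∣s∣-dichotomy -[1+ k ]     +[1+ 0 ] refl = inj₁ (cong (2 +_) (+-identityʳ k))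
∣s∣-dichotomy +0           -[1+ 0 ] refl = inj₁ refl
∣s∣-dichotomy +[1+ k ]     -[1+ 0 ] refl = inj₁ (cong suc (+-comm k 1))
∣s∣-dichotomy -[1+ 0 ]     -[1+ 0 ] refl = inj₂ refl
∣s∣-dichotomy -[1+ suc k ] -[1+ 0 ] refl = inj₂ refl

-- The edge from 0 to `e` lies between `s` and `t`, so moving `t` back by `e` contracts that edge
-- and saves exactly one unit.
∣s-t∣-across : ∀ s t e → ∣ e ∣ ≡ 1 → ∣ s ℤ.- e ∣ ≡ suc ∣ s ∣ → ∣ t ∣ ≡ suc ∣ t ℤ.- e ∣ →
               ∣ s ℤ.- t ∣ ≡ suc ∣ s ℤ.- (t ℤ.- e) ∣
∣s-t∣-across s            t            +0           ()
∣s-t∣-across s            t            +[1+ suc _ ] ()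
∣s-t∣-across s            t            -[1+ suc _ ] ()
-- For `e = 1` the hypotheses mean `s ≤ 0` and `t ≥ 1`; all other signs are contradictory.
∣s-t∣-across s            +0           +[1+ 0 ]     _ _ ()
∣s-t∣-across s            -[1+ l ]     +[1+ 0 ]     _ _ eq =
  ⊥-elim (m≢1+m+n l (trans (suc-injective eq) (cong suc (sym (+-suc l 0)))))
∣s-t∣-across +[1+ k ]     t            +[1+ 0 ]     _ ()
∣s-t∣-across +0           +[1+ 0 ]     +[1+ 0 ]     _ _ _ = refl
∣s-t∣-across +0           +[1+ suc l ] +[1+ 0 ]     _ _ _ = refl
∣s-t∣-across -[1+ k ]     +[1+ 0 ]     +[1+ 0 ]     _ _ _ = cong (2 +_) (+-identityʳ k)
∣s-t∣-across -[1+ k ]     +[1+ suc l ] +[1+ 0 ]     _ _ _ = cong (2 +_) (+-suc k l)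
-- For `e = -1` they mean `s ≥ 0` and `t ≤ -1`.
∣s-t∣-across s            +0           -[1+ 0 ]     _ _ ()
∣s-t∣-across s            +[1+ l ]     -[1+ 0 ]     _ _ eq =
  ⊥-elim (m≢1+m+n (suc l) eq)
∣s-t∣-across -[1+ 0 ]     t            -[1+ 0 ]     _ ()
∣s-t∣-across -[1+ suc k ] t            -[1+ 0 ]     _ ()
∣s-t∣-across +0           -[1+ 0 ]     -[1+ 0 ]     _ _ _ = refl
∣s-t∣-across +0           -[1+ suc l ] -[1+ 0 ]     _ _ _ = refl
∣s-t∣-across +[1+ k ]     -[1+ 0 ]     -[1+ 0 ]     _ _ _ =
  cong suc (trans (+-comm k 1) (cong suc (sym (+-identityʳ k))))
∣s-t∣-across +[1+ k ]     -[1+ suc l ] -[1+ 0 ]     _ _ _ = cong suc (+-suc k (suc l))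

dist-rebase : ∀ i j k → i ℤ.- j ≡ (i ℤ.- k) ℤ.- (j ℤ.- k)
dist-rebase = ℤ-Solver.solve-∀

-- Coordinates where `p` and `q` agree contribute equally to both distances, so the differing
-- coordinate decides.
nearer-dichotomy : {p q : Vec ℤ n} → UnitStep p q → ∀ x → Nearer p q x ⊎ Nearer q p x
nearer-dichotomy (here {i = i} {j} {p} i~j) (k ∷ x)
  with ∣s∣-dichotomy (k ℤ.- i) (j ℤ.- i) (trans (ℤ.∣i-j∣≡∣j-i∣ j i) i~j)
... | inj₁ eq = inj₁ (cong (_+ ℓ₁ x p) (trans (cong ∣_∣ (dist-rebase k j i)) eq))
... | inj₂ eq = inj₂ (cong (_+ ℓ₁ x p) (trans eq (cong (suc ∘ ∣_∣) (sym (dist-rebase k j i)))))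
nearer-dichotomy (there {i = i} {p} {q} p~q) (k ∷ x) with nearer-dichotomy p~q x
... | inj₁ eq = inj₁ (trans (cong (dist k i +_) eq) (+-suc (dist k i) (ℓ₁ x p)))
... | inj₂ eq = inj₂ (trans (cong (dist k i +_) eq) (+-suc (dist k i) (ℓ₁ x q)))

-- `shift p q` changes only the coordinate in which `p` and `q` differ, where `∣s-t∣-across`
-- applies.
ℓ₁-across : {p q : Vec ℤ n} → UnitStep p q → ∀ x y → Nearer p q x → Nearer q p y →
            ℓ₁ x y ≡ suc (ℓ₁ x (shift p q y))
ℓ₁-across (here {i = i} {j} {p} i~j) (k ∷ x) (l ∷ y) x-p y-q = cong₂ _+_
  (begin
    dist k l
      ≡⟨ cong ∣_∣ (dist-rebase k l i) ⟩
    ∣ (k ℤ.- i) ℤ.- (l ℤ.- i) ∣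
      -- The coordinate of `p` becomes the origin and `j - i` the unit `e`; the tail contributions
      -- cancel from the two hypotheses.
      ≡⟨ ∣s-t∣-across (k ℤ.- i) (l ℤ.- i) (j ℤ.- i) (trans (ℤ.∣i-j∣≡∣j-i∣ j i) i~j)
           (trans (cong ∣_∣ (sym (dist-rebase k j i))) (+-cancelʳ-≡ (ℓ₁ x p) _ _ x-p))
           (trans (+-cancelʳ-≡ (ℓ₁ y p) _ _ y-q) (cong (suc ∘ ∣_∣) (dist-rebase l j i))) ⟩
    suc ∣ (k ℤ.- i) ℤ.- ((l ℤ.- i) ℤ.- (j ℤ.- i)) ∣
      ≡⟨ cong (suc ∘ ∣_∣) (regroup i j k l) ⟩
    suc (dist k (l ℤ.+ (i ℤ.- j)))
      ∎)
  (cong (ℓ₁ x) (sym (shift-p-p p y)))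
  where
  open ≡-Reasoning
  regroup : ∀ i j k l → (k ℤ.- i) ℤ.- ((l ℤ.- i) ℤ.- (j ℤ.- i)) ≡ k ℤ.- (l ℤ.+ (i ℤ.- j))
  regroup = ℤ-Solver.solve-∀
ℓ₁-across (there {i = i} {p} {q} p~q) (k ∷ x) (l ∷ y) x-p y-q = begin
  dist k l + ℓ₁ x y
    ≡⟨ cong (dist k l +_) (ℓ₁-across p~q x y
         (+-cancelˡ-≡ (dist k i) _ _ (trans x-p (sym (+-suc (dist k i) _))))
         (+-cancelˡ-≡ (dist l i) _ _ (trans y-q (sym (+-suc (dist l i) _))))) ⟩
  dist k l + suc (ℓ₁ x (shift p q y))
    ≡⟨ +-suc (dist k l) _ ⟩
  suc (dist k l + ℓ₁ x (shift p q y))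
    ≡⟨ cong (λ l′ → suc (dist k l′ + ℓ₁ x (shift p q y))) (unmoved l i) ⟩
  suc (dist k (l ℤ.+ (i ℤ.- i)) + ℓ₁ x (shift p q y))
    ∎
  where
  open ≡-Reasoning
  unmoved : ∀ l i → l ≡ l ℤ.+ (i ℤ.- i)
  unmoved = ℤ-Solver.solve-∀

-- Contracting an edge in one lattice and restoring it in another.

module Place {m n}
  (c c′ : Vec ℤ m) (c~c′ : ℓ₁ c c′ ≡ 1)
  (p q : Vec ℤ n) (p~q : ℓ₁ p q ≡ 1)
  where

  side : ∀ x → Nearer p q x ⊎ Nearer q p x
  side = nearer-dichotomy (unitStep p q p~q)

  across : ∀ x y → Nearer p q x → Nearer q p y → ℓ₁ x y ≡ suc (ℓ₁ x (shift p q y))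
  across = ℓ₁-across (unitStep p q p~q)

  place : Vec ℤ n → Vec ℤ (m + n)
  place x with side x
  ... | inj₁ _ = c  ++ x
  ... | inj₂ _ = c′ ++ shift p q x

  -- With `place-q`, this makes the two halves of `F` agree on the identified vertices: both ends
  -- keep `p` as second block.
  place-p : place p ≡ c ++ p
  place-p with side p
  ... | inj₁ _ = refl
  ... | inj₂ p-p with () ← trans (sym (ℓ₁-refl p)) p-p

  place-q : place q ≡ c′ ++ p
  place-q with side q
  ... | inj₁ q-q with () ← trans (sym (ℓ₁-refl q)) q-q
  ... | inj₂ _ = cong (c′ ++_) (shift-q p q)

  -- Within a half, `place` is a translation. Between halves the contraction loses one unit, which
  -- the step from `c` to `c′` restores.
  place-isometry : ∀ x y → ℓ₁ (place x) (place y) ≡ ℓ₁ x y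
  place-isometry x y with side x | side y
  ... | inj₁ _   | inj₁ _   = trans (ℓ₁-++ c c x y) (cong (_+ ℓ₁ x y) (ℓ₁-refl c))
  ... | inj₁ x-p | inj₂ y-q = begin
    ℓ₁ (c ++ x) (c′ ++ shift p q y)    ≡⟨ ℓ₁-++ c c′ x (shift p q y) ⟩
    ℓ₁ c c′ + ℓ₁ x (shift p q y)       ≡⟨ cong (_+ ℓ₁ x (shift p q y)) c~c′ ⟩
    suc (ℓ₁ x (shift p q y))           ≡⟨ across x y x-p y-q ⟨
    ℓ₁ x y                             ∎
    where open ≡-Reasoning
  ... | inj₂ x-q | inj₁ y-p = begin
    ℓ₁ (c′ ++ shift p q x) (c ++ y)    ≡⟨ ℓ₁-sym (c′ ++ shift p q x) (c ++ y) ⟩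
    ℓ₁ (c ++ y) (c′ ++ shift p q x)    ≡⟨ ℓ₁-++ c c′ y (shift p q x) ⟩
    ℓ₁ c c′ + ℓ₁ y (shift p q x)       ≡⟨ cong (_+ ℓ₁ y (shift p q x)) c~c′ ⟩
    suc (ℓ₁ y (shift p q x))           ≡⟨ across y x y-p x-q ⟨
    ℓ₁ y x                             ≡⟨ ℓ₁-sym y x ⟩
    ℓ₁ x y                             ∎
    where open ≡-Reasoning
  ... | inj₂ _   | inj₂ _   = begin
    ℓ₁ (c′ ++ shift p q x) (c′ ++ shift p q y)   ≡⟨ ℓ₁-++ c′ c′ _ _ ⟩
    ℓ₁ c′ c′ + ℓ₁ (shift p q x) (shift p q y)    ≡⟨ cong₂ _+_ (ℓ₁-refl c′) (ℓ₁-translate (zipWith ℤ._-_ p q) x y) ⟩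
    ℓ₁ x y                                       ∎
    where open ≡-Reasoning

  -- The distance splits at the end of the edge on the side of `x`; the two summands are the lengths
  -- of the walks to and from that end.
  ℓ₁-place : ∀ z x → ℓ₁ (z ++ p) (place x) ≡ ℓ₁ z c + ℓ₁ p x ⊎
                     ℓ₁ (z ++ p) (place x) ≡ ℓ₁ z c′ + ℓ₁ q x
  ℓ₁-place z x with side x
  ... | inj₁ _ = inj₁ (ℓ₁-++ z c p x)
  ... | inj₂ _ = inj₂ (begin
    ℓ₁ (z ++ p) (c′ ++ shift p q x)              ≡⟨ ℓ₁-++ z c′ p (shift p q x) ⟩
    -- Writing `p` as the shift of `q` puts the same translation on both arguments.
    ℓ₁ z c′ + ℓ₁ p (shift p q x)                 ≡⟨ cong (λ r → ℓ₁ z c′ + ℓ₁ r (shift p q x)) (shift-q p q) ⟨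
    ℓ₁ z c′ + ℓ₁ (shift p q q) (shift p q x)     ≡⟨ cong (ℓ₁ z c′ +_) (ℓ₁-translate (zipWith ℤ._-_ p q) q x) ⟩
    ℓ₁ z c′ + ℓ₁ q x                             ∎)
    where open ≡-Reasoning

-- Embedding the pasted graph.

edge⇒ℓ₁≡1 : (G : Graph) (f : Vertex G → Vec ℤ n) → IsIsometric G (Lattice n) f →
            ∀ {u v} → Graph._~_ G u v → ℓ₁ (f u) (f v) ≡ 1
edge⇒ℓ₁≡1 G f iso {u} {v} u~v with ℓ₁ (f u) (f v) | isometric⇒distance G f iso u v
... | zero        | stop u≈v , _ = ⊥-elim (Graph.~-irrefl G u≈v u~v)
... | suc zero    | _            = refl
... | suc (suc _) | _ , minimal with s≤s () ← minimal 1 (step u~v (stop (Graph.≈-refl G)))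

module PasteEmbeddings
  (G₁ G₂ : Graph)
  {a₁ b₁ : Vertex G₁} (a₁b₁ : Graph._~_ G₁ a₁ b₁)
  {a₂ b₂ : Vertex G₂} (a₂b₂ : Graph._~_ G₂ a₂ b₂)
  {d₁ d₂ : ℕ}
  (E₁ : IsometricallyEmbeddable G₁ (Lattice d₁))
  (E₂ : IsometricallyEmbeddable G₂ (Lattice d₂))
  where

  open EdgePasting G₁ G₂ a₁b₁ a₂b₂

  private
    module G₁ = Graph G₁
    module G₂ = Graph G₂
    module G  = Graph pasted

  f₁ : Vertex G₁ → Vec ℤ d₁
  f₁ = Func.to (proj₁ E₁)

  f₂ : Vertex G₂ → Vec ℤ d₂
  f₂ = Func.to (proj₁ E₂)

  distance₁ : ∀ x y → Distance G₁ x y (ℓ₁ (f₁ x) (f₁ y))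
  distance₁ = isometric⇒distance G₁ f₁ (proj₂ E₁)

  distance₂ : ∀ x y → Distance G₂ x y (ℓ₁ (f₂ x) (f₂ y))
  distance₂ = isometric⇒distance G₂ f₂ (proj₂ E₂)

  f₁-edge : ∀ {x y} → x G₁.~ y → ℓ₁ (f₁ x) (f₁ y) ≡ 1
  f₁-edge = edge⇒ℓ₁≡1 G₁ f₁ (proj₂ E₁)

  f₂-edge : ∀ {x y} → x G₂.~ y → ℓ₁ (f₂ x) (f₂ y) ≡ 1
  f₂-edge = edge⇒ℓ₁≡1 G₂ f₂ (proj₂ E₂)

  open Place (f₁ a₁) (f₁ b₁) (f₁-edge a₁b₁) (f₂ a₂) (f₂ b₂) (f₂-edge a₂b₂)

  F : V → Vec ℤ (d₁ + d₂)
  F (inj₁ x) = f₁ x ++ f₂ a₂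
  F (inj₂ y) = place (f₂ y)

  F-cong : ∀ {u v} → u G.≈ v → F u ≡ F v
  F-cong = EqC.gfold isEquivalence F λ
    { (within₁ eq) → cong (_++ f₂ a₂) (Func.cong (proj₁ E₁) eq)
    ; (within₂ eq) → cong place (Func.cong (proj₁ E₂) eq)
    ; a₁≡a₂        → sym place-p
    ; b₁≡b₂        → sym place-q
    }

  F-isometric₁ : ∀ x y → ℓ₁ (F (inj₁ x)) (F (inj₁ y)) ≡ ℓ₁ (f₁ x) (f₁ y)
  F-isometric₁ x y = begin
    ℓ₁ (f₁ x ++ f₂ a₂) (f₁ y ++ f₂ a₂)         ≡⟨ ℓ₁-++ (f₁ x) (f₁ y) (f₂ a₂) (f₂ a₂) ⟩
    ℓ₁ (f₁ x) (f₁ y) + ℓ₁ (f₂ a₂) (f₂ a₂)      ≡⟨ cong (ℓ₁ (f₁ x) (f₁ y) +_) (ℓ₁-refl (f₂ a₂)) ⟩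
    ℓ₁ (f₁ x) (f₁ y) + 0                       ≡⟨ +-identityʳ _ ⟩
    ℓ₁ (f₁ x) (f₁ y)                           ∎
    where open ≡-Reasoning

  F-isometric₂ : ∀ x y → ℓ₁ (F (inj₂ x)) (F (inj₂ y)) ≡ ℓ₁ (f₂ x) (f₂ y)
  F-isometric₂ x y = place-isometry (f₂ x) (f₂ y)

  F-edge : ∀ {u v} → u ~ v → ℓ₁ (F u) (F v) ≡ 1
  F-edge (edge₁ u≈x v≈y x~y) = trans (cong₂ ℓ₁ (F-cong u≈x) (F-cong v≈y))
    (trans (F-isometric₁ _ _) (f₁-edge x~y))
  F-edge (edge₂ u≈x v≈y x~y) = trans (cong₂ ℓ₁ (F-cong u≈x) (F-cong v≈y))
    (trans (F-isometric₂ _ _) (f₂-edge x~y))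

  include₁ : Func (vertices G₁) (vertices pasted)
  include₁ = record { to = inj₁ ; cong = EqC.return ∘ within₁ }

  include₂ : Func (vertices G₂) (vertices pasted)
  include₂ = record { to = inj₂ ; cong = EqC.return ∘ within₂ }

  walk₁ : ∀ x y → Walk pasted (inj₁ x) (inj₁ y) (ℓ₁ (f₁ x) (f₁ y))
  walk₁ x y = walk-map G₁ pasted include₁ (edge₁ G.≈-refl G.≈-refl) (proj₁ (distance₁ x y))

  walk₂ : ∀ x y → Walk pasted (inj₂ x) (inj₂ y) (ℓ₁ (f₂ x) (f₂ y))
  walk₂ x y = walk-map G₂ pasted include₂ (edge₂ G.≈-refl G.≈-refl) (proj₁ (distance₂ x y))

  -- The walk goes through the end of the pasted edge selected by `ℓ₁-place`, where passing from one
  -- graph to the other costs no step.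
  F-walk₁₂ : ∀ x y → Walk pasted (inj₁ x) (inj₂ y) (ℓ₁ (F (inj₁ x)) (F (inj₂ y)))
  F-walk₁₂ x y with ℓ₁ (F (inj₁ x)) (F (inj₂ y)) | ℓ₁-place (f₁ x) (f₂ y)
  ... | _ | inj₁ refl =
    walk-trans pasted (walk₁ x a₁) (walk-respˡ pasted (EqC.return a₁≡a₂) (walk₂ a₂ y))
  ... | _ | inj₂ refl =
    walk-trans pasted (walk₁ x b₁) (walk-respˡ pasted (EqC.return b₁≡b₂) (walk₂ b₂ y))

  F-walk : ∀ u v → Walk pasted u v (ℓ₁ (F u) (F v))
  F-walk (inj₁ x) (inj₁ y) = subst (Walk pasted _ _) (sym (F-isometric₁ x y)) (walk₁ x y)
  F-walk (inj₁ x) (inj₂ y) = F-walk₁₂ x y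
  F-walk (inj₂ x) (inj₁ y) = subst (Walk pasted _ _) (ℓ₁-sym (F (inj₁ y)) (F (inj₂ x)))
    (walk-reverse pasted (F-walk₁₂ y x))
  F-walk (inj₂ x) (inj₂ y) = subst (Walk pasted _ _) (sym (F-isometric₂ x y)) (walk₂ x y)

  -- `F-walk` attains the value, and no walk is shorter because `F` gives every edge length 1.
  F-distance : ∀ u v → Distance pasted u v (ℓ₁ (F u) (F v))
  F-distance u v = F-walk u v , λ _ → walk-length≥ℓ₁ pasted F F-cong (≤-reflexive ∘ F-edge)

  pasted-embeddable : IsometricallyEmbeddable pasted (Lattice (d₁ + d₂))
  pasted-embeddable =
    record { to = F ; cong = F-cong } , distance⇒isometric pasted F F-distance

  -- Restricting an embedding of the pasted graph to its two parts.

  module _ {d : ℕ} (E : IsometricallyEmbeddable pasted (Lattice d)) where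
    private
      h : Func (vertices pasted) (vertices (Lattice d))
      h = proj₁ E

      -- Both maps realise the distance of the pasted graph. Since `F` restricts to isometries of
      -- `G₁` and `G₂`, so does any such `h`.
      h-ℓ₁ : ∀ u v → ℓ₁ (F u) (F v) ≡ ℓ₁ (Func.to h u) (Func.to h v)
      h-ℓ₁ u v = distance-unique pasted (F-distance u v)
        (isometric⇒distance pasted (Func.to h) (proj₂ E) u v)

    embeddable₁ : IsometricallyEmbeddable G₁ (Lattice d)
    embeddable₁ = compose include₁ h ,
      distance⇒isometric G₁ _ λ x y →
        subst (Distance G₁ x y) (trans (sym (F-isometric₁ x y)) (h-ℓ₁ _ _)) (distance₁ x y)

    embeddable₂ : IsometricallyEmbeddable G₂ (Lattice d)
    embeddable₂ = compose include₂ h ,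
      distance⇒isometric G₂ _ λ x y →
        subst (Distance G₂ x y) (trans (sym (F-isometric₂ x y)) (h-ℓ₁ _ _)) (distance₂ x y)

theorem7p6 : (G₁ G₂ : Graph) → Finite G₁ → Finite G₂ → IsPartialCube G₁ → IsPartialCube G₂ →
    {a₁ b₁ : Graph.Vertex G₁} (a₁b₁ : Graph._~_ G₁ a₁ b₁) →
    {a₂ b₂ : Graph.Vertex G₂} (a₂b₂ : Graph._~_ G₂ a₂ b₂) →
    IsPartialCube (edgePaste G₁ G₂ a₁b₁ a₂b₂) →
    (d₁ d₂ d : ℕ) →
    IsLatticeDimension G₁ d₁ →
    IsLatticeDimension G₂ d₂ →
    IsLatticeDimension (edgePaste G₁ G₂ a₁b₁ a₂b₂) d →
    (d₁ ⊔ d₂ ≤ d) × (d ≤ d₁ + d₂)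
theorem7p6 G₁ G₂ _ _ _ _ a₁b₁ a₂b₂ _ d₁ d₂ d (E₁ , min₁) (E₂ , min₂) (E , min) =
  ⊔-lub (min₁ d (embeddable₁ E)) (min₂ d (embeddable₂ E)) , min (d₁ + d₂) pasted-embeddable
  where open PasteEmbeddings G₁ G₂ a₁b₁ a₂b₂ E₁ E₂
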